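{- Let $m\ge 3$ be an integer, let $D\subset\{0,1,\dots,m-1\}$ with $1<\#D<m$, and let $K_{m,D}$ be the associated missing-digit set. Let $a_n=\prod_{k=1}^n k!$ for $n\in\mathbb{N}$. Then the intersection $\left\{\frac{1}{a_n}:n\in\mathbb{N}\right\}\cap K_{m,D}$ is finite.
   Context: $\mathbb{N}=\{1,2,3,\dots\}$. The missing-digit set is $K_{m,D}:=\left\{\sum_{j=1}^\infty \frac{b_j}{m^j}: b_j\in D\text{ for all }j\ge 1\right\}\subset[0,1]$. -}

module Defs where

open import Data.Fin.Base using (Fin; toℕ)
open import Data.Fin.Properties using (nonZeroIndex)
open import Data.Fin.Subset using (Subset) renaming (_∈_ to _∈ˢ_)
open import Data.Integer.Base using (+_)
open import Data.List.Base using (List)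
open import Data.List.Membership.Propositional using (_∈_)
open import Data.Nat.Base as ℕ using (ℕ; zero; suc; NonZero; _^_; _!)
open import Data.Nat.Properties using (m^n≢0; m*n≢0; _!≢0)
open import Data.Product.Base using (∃; _×_)
open import Data.Rational.Base using (ℚ; 0ℚ; _/_; _+_; _-_; _<_; ∣_∣)
open import Function.Bundles using (_⇔_)
open import Level using (Level; 0ℓ; _⊔_)
open import Relation.Binary.PropositionalEquality.Core using (_≡_)
open import Relation.Unary using (Pred)

private
  variable
    a ℓ : Level
    m : ℕ

-- Exact enumeration by a list: every member is listed and everything listed is a
-- member, so a subset of a finite set is not automatically Finite constructively.
Finite : {A : Set a} → Pred A ℓ → Set (a ⊔ ℓ)
Finite {A = A} P = ∃ λ (xs : List A) → ∀ x → P x ⇔ x ∈ xs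

infix 4 _⟶_

_⟶_ : (ℕ → ℚ) → ℚ → Set
s ⟶ x = ∀ ε → 0ℚ < ε → ∃ λ N → ∀ n → N ℕ.≤ n → ∣ s n - x ∣ < ε

digitTerm : Fin m → ℕ → ℚ
digitTerm {m} d j = + toℕ d / m ^ j
  where instance
    m^j≢0 : NonZero (m ^ j)
    m^j≢0 = m^n≢0 m j {{nonZeroIndex d}}

-- Digit sequences are indexed from 0: b i is the digit at position i + 1,
-- so partialSum b n is the sum over 1 ≤ j ≤ n of (b (j - 1)) / m ^ j.
partialSum : (ℕ → Fin m) → ℕ → ℚ
partialSum b zero    = 0ℚ
partialSum b (suc n) = partialSum b n + digitTerm (b n) (suc n)

-- The rational points of the missing-digit set K_{m,D}. The value of the
-- infinite series is expressed by convergence of its (rational) partial sums,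
-- which for a rational limit does not need the real numbers.
K : (m : ℕ) → Subset m → Pred ℚ 0ℓ
K m D x = ∃ λ (b : ℕ → Fin m) → (∀ i → b i ∈ˢ D) × partialSum b ⟶ x

superfactorial : ℕ → ℕ
superfactorial zero    = 1
superfactorial (suc n) = superfactorial n ℕ.* suc n !

superfactorial≢0 : ∀ n → NonZero (superfactorial n)
superfactorial≢0 zero    = _
superfactorial≢0 (suc n) =
  m*n≢0 (superfactorial n) (suc n !) {{superfactorial≢0 n}} {{suc n !≢0}}

1/superfactorial : ℕ → ℚ
1/superfactorial n = (+ 1 / superfactorial n) {{superfactorial≢0 n}}

Reciprocals : Pred ℚ 0ℓ
Reciprocals x = ∃ λ n → 1 ℕ.≤ n × x ≡ 1/superfactorial n

{-# OPTIONS --safe #-}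

-- Write A for superfactorial n. Fix a prime p dividing m ∸ 1 and factor
-- A = w s pᵉ, where w divides a power of m, s is coprime to m and p ∤ s. For a
-- suitable T = p n! t pⁱ with p ∤ t one has mᵀ = 1 + z c with z = s pᵉ⁻ᵍ and
-- p ∤ c: s is a product of numbers j ≤ n prime to m, for which m ^ n! ≡ 1 mod j, and
-- n! has far fewer factors p than A. Hence multiplying repeatedly by mᵀ moves a
-- power of m modulo A through an arithmetic progression of step A / pᵍ, which
-- for pᵍ ≥ 2 m meets every interval [d A / m, (d + 1) A / m]. So for all large n
-- every digit d occurs in the expansion of 1 / A. That expansion is unique as
-- p divides A but not m, and a missing digit excludes 1 / A from K.
--
-- The finitely many remaining n need a decision procedure: a / N lies in K iff
-- the graph of remainders 0 , … , N has an infinite path starting at a, which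
-- is decidable since the graph is finite.
module Submission where

open import Defs
open import Data.Nat.Base using (ℕ; _≤_; _<_)
open import Data.Fin.Subset using (Subset; ∣_∣)
open import Relation.Unary using (_∩_)

open import Data.Fin.Base using (Fin; toℕ; fromℕ<)
open import Data.Fin.Properties using (pigeonhole; toℕ-fromℕ<; toℕ<n; toℕ-injective; any?)
open import Data.Fin.Subset using (_∈_; _∉_; ⊤)
open import Data.Fin.Subset.Properties using (_∈?_; ∣⊤∣≡n; p⊆q⇒∣p∣≤∣q∣)
open import Data.Integer.Base as ℤ using (+_; +0; +[1+_])
import Data.Integer.Properties as ℤ
open import Data.List.Base using (_∷_; map; filter; applyUpTo)
open import Data.List.Membership.Propositional using () renaming (_∈_ to _∈ˡ_)
open import Data.List.Membership.Propositional.Properties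
  using (∈-map⁺; ∈-map⁻; ∈-filter⁺; ∈-filter⁻; ∈-applyUpTo⁺; ∈-applyUpTo⁻)
open import Data.List.Relation.Unary.All using (_∷_)
open import Data.Nat.Base hiding (ℕ; _≤_; _<_)
open import Data.Nat.Coprimality
  using (Coprime; coprime-divisor; coprime-Bézout; gcd≡1⇒coprime) renaming (sym to coprime-sym)
open import Data.Nat.DivMod using (_mod_; m≡m%n+[m/n]*n; m%n<n)
open import Data.Nat.Divisibility
open import Data.Nat.GCD using (gcd; gcd[m,n]∣m; gcd[m,n]∣n; module Bézout)
open import Data.Nat.Induction using (<-rec)
open import Data.Nat.ListAction using (product)
open import Data.Nat.Primality
  using (Prime; prime⇒irreducible; ¬prime[1]; prime⇒nonZero; prime⇒nonTrivial)
open import Data.Nat.Primality.Factorisation using (factorise)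
open import Data.Nat.Properties
open import Data.Nat.Tactic.RingSolver using (solve-∀)
open import Data.Product.Base using (∃; ∃₂; _×_; _,_; proj₁; proj₂; map₂)
open import Data.Rational.Base as ℚ using (mkℚ; 0ℚ; toℚᵘ)
import Data.Rational.Properties as ℚ
open import Data.Rational.Unnormalised.Base as ℚᵘ using (mkℚᵘ; *≡*; *<*)
import Data.Rational.Unnormalised.Properties as ℚᵘ
open import Data.Sum.Base using (inj₁; inj₂)
open import Function.Base using (_∘_; it)
open import Function.Bundles using (_⇔_; mk⇔; Equivalence)
open import Level using (0ℓ)
open import Relation.Binary.Core using (Rel)
open import Relation.Binary.Definitions using (Decidable)
open import Relation.Binary.PropositionalEquality
open import Relation.Nullary.Decidable
  using (Dec; yes; no; _×-dec_; map′; ¬?; decidable-stable)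
open import Relation.Nullary.Negation using (¬_; contradiction)
open import Relation.Unary using (Pred)

-- Coprimality and valuations

coprime-* : ∀ {a b c} → Coprime a b → Coprime a c → Coprime a (b * c)
coprime-* {a} {b} ab ac (i∣a , i∣bc) = ac (i∣a , coprime-divisor ib i∣bc)
  where
  ib : Coprime _ b
  ib (j∣i , j∣b) = ab (∣-trans j∣i i∣a , j∣b)

coprime-^ : ∀ {a b} k → Coprime a b → Coprime a (b ^ k)
coprime-^ zero    ab (_ , i∣1) = ∣1⇒≡1 i∣1
coprime-^ (suc k) ab           = coprime-* ab (coprime-^ k ab)

coprime-∣ʳ : ∀ {a b c} → c ∣ b → Coprime a b → Coprime a c
coprime-∣ʳ c∣b ab (i∣a , i∣c) = ab (i∣a , ∣-trans i∣c c∣b)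

coprime-1+ : ∀ {p a} → p ∣ a → Coprime p (1 + a)
coprime-1+ {a = a} p∣a {i} (i∣p , i∣1+a) =
  ∣1⇒≡1 (∣m+n∣m⇒∣n (subst (i ∣_) (+-comm 1 a) i∣1+a) (∣-trans i∣p p∣a))

prime∤⇒coprime : ∀ {p x} → Prime p → p ∤ x → Coprime p x
prime∤⇒coprime pp p∤x (i∣p , i∣x) with prime⇒irreducible pp i∣p
... | inj₁ i≡1  = i≡1
... | inj₂ refl = contradiction i∣x p∤x

∃-prime-divisor : ∀ n → 2 ≤ n → ∃ λ p → Prime p × p ∣ n
∃-prime-divisor n@(2+ _) (s≤s (s≤s _)) with factorise n
... | record { factors = p ∷ ps ; isFactorisation = eq ; factorsPrime = pp ∷ _ } =
  p , pp , subst (p ∣_) (sym eq) (m∣m*n (product ps))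

-- Splits off the part of n composed of primes dividing m.
coprime-part : ∀ m n → .{{NonZero n}} →
  ∃ λ w → ∃ λ s → ∃ λ k → n ≡ w * s × w ∣ m ^ k × Coprime s m
coprime-part m = <-rec Split split
  where
  Split : ℕ → Set
  Split n = .{{NonZero n}} →
    ∃ λ w → ∃ λ s → ∃ λ k → n ≡ w * s × w ∣ m ^ k × Coprime s m

  split : ∀ n → (∀ {i} → i < n → Split i) → Split n
  split n rec with gcd n m in eq | gcd[m,n]∣m n m | gcd[m,n]∣n n m
  ... | 0    | 0∣n         | _   = contradiction (0∣⇒≡0 0∣n) (≢-nonZero⁻¹ n)
  ... | 1    | _           | _   =
    1 , n , 0 , sym (*-identityˡ n) , ∣-refl , gcd≡1⇒coprime eq
  ... | g@(2+ _) | g∣n@(divides q n≡q*g) | g∣m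
    with w , s , k , q≡ws , w∣ , sm ← rec (quotient-< g∣n) {{quotient≢0 g∣n}} =
      g * w , s , suc k , eq′ , *-pres-∣ g∣m w∣ , sm
    where
    eq′ : n ≡ g * w * s
    eq′ = trans n≡q*g (trans (*-comm q g) (trans (cong (g *_) q≡ws) (sym (*-assoc g w s))))

valuation : ∀ {p} → Prime p → ∀ n → .{{NonZero n}} →
  ∃₂ λ v r → n ≡ p ^ v * r × Coprime p r
valuation {p} pp = <-rec Val val
  where
  Val : ℕ → Set
  Val n = .{{NonZero n}} → ∃₂ λ v r → n ≡ p ^ v * r × Coprime p r

  val : ∀ n → (∀ {i} → i < n → Val i) → Val n
  val n rec with p ∣? n
  ... | no p∤n = 0 , n , sym (*-identityˡ n) , prime∤⇒coprime pp p∤n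
  ... | yes p∣n@(divides q n≡q*p)
    with v , r , q≡ , pr ← rec (quotient-< p∣n {{prime⇒nonTrivial pp}}) {{quotient≢0 p∣n}} =
      suc v , r , trans n≡q*p (trans (*-comm q p)
        (trans (cong (p *_) q≡) (sym (*-assoc p (p ^ v) r)))) , pr

^-∣-cancel : ∀ {p} → Prime p → ∀ {x e r} → Coprime p r → p ^ x ∣ p ^ e * r → x ≤ e
^-∣-cancel pp {zero} _ _ = z≤n
^-∣-cancel {p} pp {suc x} {zero} {r} pr d =
  contradiction (subst Prime (pr (∣-refl , p∣r)) pp) ¬prime[1]
  where
  p∣r : p ∣ r
  p∣r = subst (p ∣_) (*-identityˡ r) (∣-trans (m∣m*n (p ^ x)) d)
^-∣-cancel {p} pp {suc x} {suc e} {r} pr d =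
  s≤s (^-∣-cancel pp pr (*-cancelˡ-∣ p {{prime⇒nonZero pp}}
    (subst (p * p ^ x ∣_) (*-assoc p (p ^ e) r) d)))

-- Linear congruences

inverse : ∀ {a P} → 2 ≤ P → Coprime a P → ∃₂ λ x y → x * a ≡ 1 + y * P
inverse {a} {P} 2≤P aP with coprime-Bézout aP
... | Bézout.+- x y eq = x , y , sym eq
-- Here `x * a` is -1 modulo P, so multiplying once more by `x * a` gives 1.
... | Bézout.-+ x y eq with x * a in xa
...   | zero  = contradiction (∣1⇒≡1 (divides y eq)) (<⇒≢ 2≤P ∘ sym)
...   | suc k = x * suc k , k * y , eq′
  where
  open ≡-Reasoning
  lemma₁ : ∀ x k a → x * k * a ≡ k * (x * a)
  lemma₁ = solve-∀
  lemma₂ : ∀ k → (1 + k) * (1 + k) ≡ 1 + k * (1 + (1 + k))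
  lemma₂ = solve-∀
  eq′ : x * suc k * a ≡ 1 + k * y * P
  eq′ = begin
    x * suc k * a           ≡⟨ lemma₁ x (suc k) a ⟩
    suc k * (x * a)         ≡⟨ cong (suc k *_) xa ⟩
    suc k * suc k           ≡⟨ lemma₂ k ⟩
    1 + k * (1 + suc k)     ≡⟨ cong (λ z → 1 + k * z) eq ⟩
    1 + k * (y * P)         ≡⟨ cong suc (*-assoc k y P) ⟨
    1 + k * y * P           ∎

linear-congruence : ∀ {a P} → 2 ≤ P → Coprime a P → ∀ q i →
  ∃₂ λ j t → q + a * j ≡ i + P * t
linear-congruence {a} {P@(suc P-1)} 2≤P aP q i with x , y , eq ← inverse 2≤P aP =
  x * r , q + y * r , (begin
    q + a * (x * r)              ≡⟨ lemma₁ q a x r ⟩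
    q + x * a * r                ≡⟨ cong (λ z → q + z * r) eq ⟩
    q + (1 + y * P) * r          ≡⟨ lemma₂ q y P-1 i ⟩
    i + P * (q + y * r)          ∎)
  where
  open ≡-Reasoning
  -- Represents i - q modulo P without subtraction.
  r = i + P-1 * q
  lemma₁ : ∀ q a x r → q + a * (x * r) ≡ q + x * a * r
  lemma₁ = solve-∀
  lemma₂ : ∀ q y P i → q + (1 + y * (1 + P)) * (i + P * q) ≡ i + (1 + P) * (q + y * (i + P * q))
  lemma₂ = solve-∀

-- Powers congruent to 1 and lifting the exponent

infix 4 _≡1[mod_]

_≡1[mod_] : ℕ → ℕ → Set
u ≡1[mod s ] = ∃ λ a → u ≡ 1 + a × s ∣ a

-- The binomial theorem to second order, with σ collecting the higher terms: the cofactor of a is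
-- congruent to t modulo a.
[1+a]^t : ∀ a t → ∃ λ σ → (1 + a) ^ t ≡ 1 + a * (t + a * σ)
[1+a]^t a zero    = 0 , lemma a
  where
  lemma : ∀ a → 1 ≡ 1 + a * (0 + a * 0)
  lemma = solve-∀
[1+a]^t a (suc t) with σ , eq ← [1+a]^t a t =
  σ + t + a * σ , trans (cong ((1 + a) *_) eq) (lemma a t σ)
  where
  lemma : ∀ a t σ → (1 + a) * (1 + a * (t + a * σ)) ≡ 1 + a * ((1 + t) + a * (σ + t + a * σ))
  lemma = solve-∀

≡1-^ : ∀ {u s} k → u ≡1[mod s ] → u ^ k ≡1[mod s ]
≡1-^ k (a , refl , s∣a) with σ , eq ← [1+a]^t a k = _ , eq , ∣m⇒∣m*n _ s∣a

-- Writing u = 1 + a, the exponent s makes the second-order cofactor `s + a * σ` divisible by s,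
-- while a itself is divisible by r.
≡1-lift : ∀ {u r s} → u ≡1[mod r ] → u ≡1[mod s ] → u ^ s ≡1[mod r * s ]
≡1-lift {s = s} (a , refl , r∣a) (_ , refl , s∣a) with σ , eq ← [1+a]^t a s =
  _ , eq , *-pres-∣ r∣a (∣m∣n⇒∣m+n ∣-refl (∣m⇒∣m*n σ s∣a))

valuation-^-coprime : ∀ {p f c} t → Coprime p c → Coprime p t →
  ∃ λ c′ → (1 + p ^ suc f * c) ^ t ≡ 1 + p ^ suc f * c′ × Coprime p c′
valuation-^-coprime {p} {f} {c} t pc pt with σ , eq ← [1+a]^t (p ^ suc f * c) t =
  c * (t + p ^ suc f * c * σ) , trans eq (cong suc (*-assoc (p ^ suc f) c _)) ,
  coprime-* pc coprime-+
  where
  coprime-+ : Coprime p (t + p ^ suc f * c * σ)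
  coprime-+ {i} (i∣p , i∣t+) = pt (i∣p , ∣m+n∣m⇒∣n (subst (i ∣_) (+-comm t _) i∣t+)
    (∣m⇒∣m*n σ (∣m⇒∣m*n c (∣m⇒∣m*n (p ^ f) i∣p))))

-- The second-order cofactor has exactly one factor p as soon as `p ^ 2` divides the base minus 1.
-- Starting from exponent 2 therefore covers p = 2 together with the odd primes.
valuation-^-self : ∀ {p f c} → Coprime p c →
  ∃ λ c′ → (1 + p ^ (2 + f) * c) ^ p ≡ 1 + p ^ (3 + f) * c′ × Coprime p c′
valuation-^-self {p} {f} {c} pc with σ , eq ← [1+a]^t (p ^ (2 + f) * c) p =
  c * (1 + p * (p ^ f * c * σ)) , trans eq (cong suc (lemma p (p ^ f) c σ)) ,
  coprime-* pc (coprime-1+ (m∣m*n _))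
  where
  lemma : ∀ p q c σ → p * (p * q) * c * (p + p * (p * q) * c * σ) ≡
                      p * (p * (p * q)) * (c * (1 + p * (q * c * σ)))
  lemma = solve-∀

valuation-^-^ : ∀ {p f c} v → Coprime p c →
  ∃ λ c′ → (1 + p ^ (2 + f) * c) ^ (p ^ v) ≡ 1 + p ^ (2 + (v + f)) * c′ × Coprime p c′
valuation-^-^ {c = c} zero pc = c , *-identityʳ _ , pc
valuation-^-^ {p} {f} {c} (suc v) pc
  with c₁ , eq₁ , pc₁ ← valuation-^-^ {p} {f} v pc
  with c₂ , eq₂ , pc₂ ← valuation-^-self {p} {v + f} pc₁ = c₂ , (begin
    u ^ (p * p ^ v)                     ≡⟨ cong (u ^_) (*-comm p (p ^ v)) ⟩
    u ^ (p ^ v * p)                     ≡⟨ ^-*-assoc u (p ^ v) p ⟨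
    (u ^ (p ^ v)) ^ p                   ≡⟨ cong (_^ p) eq₁ ⟩
    (1 + p ^ (2 + (v + f)) * c₁) ^ p    ≡⟨ eq₂ ⟩
    1 + p ^ (3 + (v + f)) * c₂          ∎) , pc₂
  where
  open ≡-Reasoning
  u = 1 + p ^ (2 + f) * c

-- Lifting the exponent: n adds its own valuation v. The part `p ^ v` of n is treated first, the
-- part r prime to p last.
valuation-^ : ∀ {p f c} → Prime p → Coprime p c → ∀ n → .{{NonZero n}} →
  ∃₂ λ v r → n ≡ p ^ v * r × Coprime p r ×
  (∃ λ c′ → (1 + p ^ (2 + f) * c) ^ n ≡ 1 + p ^ (2 + (v + f)) * c′ × Coprime p c′)
valuation-^ {p} {f} {c} pp pc n
  with v , r , n≡ , pr ← valuation pp n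
  with c₁ , eq₁ , pc₁ ← valuation-^-^ {p} {f} v pc
  with c₂ , eq₂ , pc₂ ← valuation-^-coprime {p} {1 + (v + f)} r pc₁ pr =
  v , r , n≡ , pr , c₂ , (begin
    u ^ n                               ≡⟨ cong (u ^_) n≡ ⟩
    u ^ (p ^ v * r)                     ≡⟨ ^-*-assoc u (p ^ v) r ⟨
    (u ^ (p ^ v)) ^ r                   ≡⟨ cong (_^ r) eq₁ ⟩
    (1 + p ^ (2 + (v + f)) * c₁) ^ r    ≡⟨ eq₂ ⟩
    1 + p ^ (2 + (v + f)) * c₂          ∎) , pc₂
  where
  open ≡-Reasoning
  u = 1 + p ^ (2 + f) * c

mod-≡⇒∣∸ : ∀ {a b} s → .{{_ : NonZero s}} → a ≤ b → a % s ≡ b % s → s ∣ b ∸ a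
mod-≡⇒∣∸ {a} {b} s a≤b eq = divides (b / s ∸ a / s) (begin
  b ∸ a                                       ≡⟨ cong₂ _∸_ (m≡m%n+[m/n]*n b s) (m≡m%n+[m/n]*n a s) ⟩
  (b % s + b / s * s) ∸ (a % s + a / s * s)   ≡⟨ cong (λ z → (b % s + b / s * s) ∸ (z + a / s * s)) eq ⟩
  (b % s + b / s * s) ∸ (b % s + a / s * s)   ≡⟨ [m+n]∸[m+o]≡n∸o (b % s) _ _ ⟩
  b / s * s ∸ a / s * s                       ≡⟨ *-distribʳ-∸ s (b / s) (a / s) ⟨
  (b / s ∸ a / s) * s                         ∎)
  where open ≡-Reasoning

-- The order of m modulo s is at most s (pigeonhole), hence divides n !.
^!≡1 : ∀ {m s n} → .{{NonZero m}} → .{{NonZero s}} → Coprime s m → s ≤ n →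
  m ^ (n !) ≡1[mod s ]
^!≡1 {m} {s} {n} sm s≤n
  with i , j , i<j , eq ← pigeonhole (n<1+n s) (λ i → (m ^ toℕ i) mod s) =
  subst (_≡1[mod s ])
    (trans (^-*-assoc m l q) (cong (m ^_) (trans (*-comm l q) (sym n!≡))))
    (≡1-^ q m^l≡1)
  where
  l = toℕ j ∸ toℕ i
  l≤n : l ≤ n
  l≤n = ≤-trans (m∸n≤m (toℕ j) (toℕ i)) (≤-trans (s≤s⁻¹ (toℕ<n j)) s≤n)
  instance
    l≢0 : NonZero l
    l≢0 = >-nonZero (m<n⇒0<n∸m i<j)
  l∣n! : l ∣ n !
  l∣n! = ∣-trans (l∣l! l) (m≤n⇒m!∣n! l≤n)
    where
    l∣l! : ∀ l → .{{NonZero l}} → l ∣ l !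
    l∣l! (suc l) = m∣m*n (l !)
  q = quotient l∣n!
  n!≡ : n ! ≡ q * l
  n!≡ = m∣n⇒n≡quotient*m l∣n!
  %-eq : m ^ toℕ i % s ≡ m ^ toℕ j % s
  %-eq = trans (sym (toℕ-fromℕ< _)) (trans (cong toℕ eq) (toℕ-fromℕ< _))
  1≤m^l : 1 ≤ m ^ l
  1≤m^l = m^n>0 m l
  diff : m ^ toℕ j ∸ m ^ toℕ i ≡ m ^ toℕ i * (m ^ l ∸ 1)
  diff = begin
    m ^ toℕ j ∸ m ^ toℕ i              ≡⟨ cong (λ z → m ^ z ∸ m ^ toℕ i) (m+[n∸m]≡n (<⇒≤ i<j)) ⟨
    m ^ (toℕ i + l) ∸ m ^ toℕ i
      ≡⟨ cong₂ _∸_ (^-distribˡ-+-* m (toℕ i) l) (sym (*-identityʳ (m ^ toℕ i))) ⟩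
    m ^ toℕ i * m ^ l ∸ m ^ toℕ i * 1  ≡⟨ *-distribˡ-∸ (m ^ toℕ i) (m ^ l) 1 ⟨
    m ^ toℕ i * (m ^ l ∸ 1)            ∎
    where open ≡-Reasoning
  m^l≡1 : m ^ l ≡1[mod s ]
  m^l≡1 = m ^ l ∸ 1 , sym (m+[n∸m]≡n 1≤m^l) ,
    coprime-divisor (coprime-^ (toℕ i) sm)
      (subst (s ∣_) diff (mod-≡⇒∣∸ s (^-monoʳ-≤ m (<⇒≤ i<j)) %-eq))

-- Digits of 1 / superfactorial n

-- The digit d occurs in the base m expansion of 1 / A.
DigitOccurs : ℕ → ℕ → ℕ → Set
DigitOccurs m A d = ∃₂ λ k q → ∃₂ λ y y′ →
  m ^ k ≡ y + A * q × m * y ≡ d * A + y′ × y′ < A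

-- The powers m ^ (κ + T * j) run modulo A through r + w * z * i for all i,
-- and these residues are spaced by A / P ≤ A / (2 * m).
digit-occurs : ∀ {m w h κ T z c P} → .{{NonZero m}} → .{{NonZero (w * z)}} →
  m ^ κ ≡ w * h → m ^ T ≡ 1 + z * c → P ∣ z → Coprime (h * c) P → 2 * m ≤ P →
  ∀ d → DigitOccurs m (w * z * P) d
digit-occurs {m} {w} {h} {κ} {T} {z} {c} {P} m^κ m^T (divides z₂ z≡) hcP 2m≤P d
  -- The progression index `q₀ + h * c * j` is steered to i modulo P, where i is the least integer
  -- above d * P / m.
  with j , t , lin ← linear-congruence {h * c} {P} (≤-trans (*-monoʳ-≤ 2 (>-nonZero⁻¹ m)) 2m≤P) hcP
    (w * h / (w * z)) (suc (d * P / m))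
  with σ , bin ← [1+a]^t (z * c) j
  = κ + T * j , t + z₂ * x , r + wz * i , m * (r + wz * i) ∸ d * A ,
    power , sym (m+[n∸m]≡n dA≤) ,
    +-cancelˡ-< (d * A) _ _ (subst (_< d * A + A) (sym (m+[n∸m]≡n dA≤)) <dA+A)
  where
  wz = w * z
  A = wz * P
  q₀ = w * h / wz
  r = w * h % wz
  i = suc (d * P / m)
  x = h * c * c * σ

  mi≡ : m * i + d * P % m ≡ d * P + m
  mi≡ = trans (lemma m (d * P / m) (d * P % m)) (cong (_+ m) (sym (m≡m%n+[m/n]*n (d * P) m)))
    where
    lemma : ∀ m q r → m * (1 + q) + r ≡ r + q * m + m
    lemma = solve-∀
  dP≤mi : d * P ≤ m * i
  dP≤mi = +-cancelʳ-≤ m (d * P) (m * i)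
    (subst (_≤ m * i + m) mi≡ (+-monoʳ-≤ (m * i) (<⇒≤ (m%n<n (d * P) m))))
  mi≤ : m * i ≤ d * P + m
  mi≤ = subst (m * i ≤_) mi≡ (m≤m+n _ _)

  dA≤ : d * A ≤ m * (r + wz * i)
  dA≤ = begin
    d * (wz * P)        ≡⟨ lemma₁ d wz P ⟩
    wz * (d * P)        ≤⟨ *-monoʳ-≤ wz dP≤mi ⟩
    wz * (m * i)        ≤⟨ m≤n+m _ (m * r) ⟩
    m * r + wz * (m * i) ≡⟨ lemma₂ m r wz i ⟩
    m * (r + wz * i)    ∎
    where
    open ≤-Reasoning
    lemma₁ : ∀ d a P → d * (a * P) ≡ a * (d * P)
    lemma₁ = solve-∀
    lemma₂ : ∀ m r a i → m * r + a * (m * i) ≡ m * (r + a * i)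
    lemma₂ = solve-∀

  -- The slack 2 * m consists of one m for r < wz and one m for rounding i up.
  <dA+A : m * (r + wz * i) < d * A + A
  <dA+A = begin-strict
    m * (r + wz * i)              ≡⟨ lemma₁ m r wz i ⟩
    m * r + wz * (m * i)          <⟨ +-monoˡ-< _ (*-monoʳ-< m (m%n<n (w * h) wz)) ⟩
    m * wz + wz * (m * i)         ≤⟨ +-monoʳ-≤ (m * wz) (*-monoʳ-≤ wz mi≤) ⟩
    m * wz + wz * (d * P + m)     ≡⟨ lemma₂ m wz d P ⟩
    wz * (d * P) + wz * (2 * m)   ≤⟨ +-monoʳ-≤ (wz * (d * P)) (*-monoʳ-≤ wz 2m≤P) ⟩
    wz * (d * P) + wz * P         ≡⟨ lemma₃ wz d P ⟩
    d * (wz * P) + wz * P         ∎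
    where
    open ≤-Reasoning
    lemma₁ : ∀ m r a i → m * (r + a * i) ≡ m * r + a * (m * i)
    lemma₁ = solve-∀
    lemma₂ : ∀ m a d P → m * a + a * (d * P + m) ≡ a * (d * P) + a * (2 * m)
    lemma₂ = solve-∀
    lemma₃ : ∀ a d P → a * (d * P) + a * P ≡ d * (a * P) + a * P
    lemma₃ = solve-∀

  power : m ^ (κ + T * j) ≡ r + wz * i + A * (t + z₂ * x)
  power = begin
    m ^ (κ + T * j)                                ≡⟨ ^-distribˡ-+-* m κ (T * j) ⟩
    m ^ κ * m ^ (T * j)
      ≡⟨ cong₂ _*_ m^κ (trans (sym (^-*-assoc m T j)) (cong (_^ j) m^T)) ⟩
    w * h * (1 + z * c) ^ j                        ≡⟨ cong (w * h *_) bin ⟩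
    w * h * (1 + z * c * (j + z * c * σ))          ≡⟨ lemma₁ w h z c j σ ⟩
    -- Since P divides z, the quadratic term is a multiple of A and only the term linear in j moves
    -- the residue.
    w * h + (wz * (h * c * j) + wz * z * x)
      ≡⟨ cong₂ (λ a b → a + (wz * (h * c * j) + wz * b * x)) (m≡m%n+[m/n]*n (w * h) wz) z≡ ⟩
    r + q₀ * wz + (wz * (h * c * j) + wz * (z₂ * P) * x) ≡⟨ lemma₂ r q₀ wz (h * c * j) z₂ P x ⟩
    r + wz * (q₀ + h * c * j) + A * (z₂ * x)       ≡⟨ cong (λ a → r + wz * a + A * (z₂ * x)) lin ⟩
    r + wz * (i + P * t) + A * (z₂ * x)            ≡⟨ lemma₃ r wz i P t (z₂ * x) ⟩
    r + wz * i + A * (t + z₂ * x)                  ∎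
    where
    open ≡-Reasoning
    lemma₁ : ∀ w h z c j σ → w * h * (1 + z * c * (j + z * c * σ)) ≡
      w * h + (w * z * (h * c * j) + w * z * z * (h * c * c * σ))
    lemma₁ = solve-∀
    lemma₂ : ∀ r q a b z P x → r + q * a + (a * b + a * (z * P) * x) ≡ r + a * (q + b) + a * P * (z * x)
    lemma₂ = solve-∀
    lemma₃ : ∀ r a i P t x → r + a * (i + P * t) + a * P * x ≡ r + a * i + a * P * (t + x)
    lemma₃ = solve-∀

-- t is prime to p, so u ^ t ∸ 1 has no more factors p than u ∸ 1.
record Split (m p u A : ℕ) : Set where
  field
    w κ s t e : ℕ
    factored  : A ≡ w * s * p ^ e
    w∣m^κ     : w ∣ m ^ κ
    p⊥s       : Coprime p s
    p⊥t       : Coprime p t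
    u^t≡1     : u ^ t ≡1[mod s ]

-- The two moduli s may share factors, so their product is reached by `≡1-lift`. Its extra exponent
-- `τ.s` is prime to p and can be absorbed into t.
split-* : ∀ {m p u A B} → Split m p u A → Split m p u B → Split m p u (A * B)
split-* {m} {p} {u} σ τ = record
  { w = σ.w * τ.w ; κ = σ.κ + τ.κ ; s = σ.s * τ.s ; t = σ.t * τ.t * τ.s ; e = σ.e + τ.e
  ; factored = trans (cong₂ _*_ σ.factored τ.factored)
      (trans (lemma σ.w σ.s (p ^ σ.e) τ.w τ.s (p ^ τ.e))
      (cong (σ.w * τ.w * (σ.s * τ.s) *_) (sym (^-distribˡ-+-* p σ.e τ.e))))
  ; w∣m^κ = subst (_ ∣_) (sym (^-distribˡ-+-* m σ.κ τ.κ)) (*-pres-∣ σ.w∣m^κ τ.w∣m^κ)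
  ; p⊥s = coprime-* σ.p⊥s τ.p⊥s
  ; p⊥t = coprime-* (coprime-* σ.p⊥t τ.p⊥t) τ.p⊥s
  ; u^t≡1 = subst (_≡1[mod σ.s * τ.s ]) (^-*-assoc u (σ.t * τ.t) τ.s) (≡1-lift
      (subst (_≡1[mod σ.s ]) (^-*-assoc u σ.t τ.t) (≡1-^ τ.t σ.u^t≡1))
      (subst (_≡1[mod τ.s ]) (trans (^-*-assoc u τ.t σ.t) (cong (u ^_) (*-comm τ.t σ.t)))
        (≡1-^ σ.t τ.u^t≡1)))
  }
  where
  module σ = Split σ
  module τ = Split τ
  lemma : ∀ w s q w′ s′ q′ → w * s * q * (w′ * s′ * q′) ≡ w * w′ * (s * s′) * (q * q′)
  lemma = solve-∀

-- Once the primes of m and p are removed from j, the cofactor s is at most n and prime to m, so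
-- `m ^ (n !)` is already 1 modulo s.
split-≤ : ∀ {m p n} → .{{NonZero m}} → Prime p → ∀ j → .{{NonZero j}} → j ≤ n → Split m p (m ^ (n !)) j
split-≤ {m} {p} {n} pp j j≤n
  with w , s′ , κ , j≡ , w∣m^κ , s′⊥m ← coprime-part m j
  with e , s , s′≡ , p⊥s ← valuation pp s′ {{m*n≢0⇒n≢0 w {{subst NonZero j≡ it}}}} = record
  { w = w ; κ = κ ; s = s ; t = 1 ; e = e
  ; factored = j≡wsp^e
  ; w∣m^κ = w∣m^κ
  ; p⊥s = p⊥s
  ; p⊥t = λ (_ , i∣1) → ∣1⇒≡1 i∣1
  ; u^t≡1 = ≡1-^ 1 (^!≡1 {{it}} {{s≢0}} (coprime-sym (coprime-∣ʳ s∣s′ (coprime-sym s′⊥m)))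
      (≤-trans (∣⇒≤ s∣j) j≤n))
  }
  where
  s∣s′ : s ∣ s′
  s∣s′ = divides (p ^ e) s′≡
  j≡wsp^e : j ≡ w * s * p ^ e
  j≡wsp^e = trans j≡ (trans (cong (w *_) (trans s′≡ (*-comm (p ^ e) s))) (sym (*-assoc w s (p ^ e))))
  s∣j : s ∣ j
  s∣j = subst (s ∣_) (sym j≡) (∣n⇒∣m*n w s∣s′)
  s≢0 : NonZero s
  s≢0 = ≢-nonZero λ s≡0 → ≢-nonZero⁻¹ j (0∣⇒≡0 (subst (_∣ j) s≡0 s∣j))

-- The base `m ^ (n !)` stays fixed while k grows, so the splits of all factors up to n can be
-- multiplied.
split-superfactorial : ∀ {m p n} → .{{NonZero m}} → Prime p → ∀ k → k ≤ n →
  Split m p (m ^ (n !)) (superfactorial k)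
split-superfactorial {m} {p} {n} pp = split-sf
  where
  split-1 : Split m p (m ^ (n !)) 1
  split-1 = record
    { w = 1 ; κ = 0 ; s = 1 ; t = 1 ; e = 0 ; factored = refl ; w∣m^κ = ∣-refl
    ; p⊥s = λ (_ , i∣1) → ∣1⇒≡1 i∣1 ; p⊥t = λ (_ , i∣1) → ∣1⇒≡1 i∣1
    ; u^t≡1 = m ^ (n !) * 1 ∸ 1 ,
        sym (m+[n∸m]≡n (subst (1 ≤_) (sym (*-identityʳ (m ^ (n !)))) (m^n>0 m (n !)))) , 1∣ _ }
  split-! : ∀ k → k ≤ n → Split m p (m ^ (n !)) (k !)
  split-! zero    _   = split-1
  split-! (suc k) k<n = split-* (split-≤ pp (suc k) k<n) (split-! k (<⇒≤ k<n))
  split-sf : ∀ k → k ≤ n → Split m p (m ^ (n !)) (superfactorial k)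
  split-sf zero    _   = split-1
  split-sf (suc k) k<n = split-* (split-sf k (<⇒≤ k<n)) (split-! (suc k) k<n)

-- Powers of p in the superfactorial

^-monoʳ-∣ : ∀ p {k l} → k ≤ l → p ^ k ∣ p ^ l
^-monoʳ-∣ p {k} k≤l with o , refl ← m≤n⇒∃[o]m+o≡n k≤l =
  subst (p ^ k ∣_) (sym (^-distribˡ-+-* p k o)) (m∣m*n (p ^ o))

-- Each factor `k !` with k at least p contributes one p.
p^l∣superfactorial : ∀ p .{{_ : NonZero p}} l {n} → l + p ≤ n → p ^ l ∣ superfactorial n
p^l∣superfactorial p           zero    _       = 1∣ _
p^l∣superfactorial p@(suc p-1) (suc l) {suc n} l+p<n =
  subst (p ^ suc l ∣_) (*-comm _ (superfactorial n))
    (*-pres-∣ (∣-trans (m∣m*n {p} (p-1 !)) (m≤n⇒m!∣n! (≤-trans (m≤n+m p (suc l)) l+p<n)))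
              (p^l∣superfactorial p l (s≤s⁻¹ l+p<n)))

n<p^n : ∀ {p} → 2 ≤ p → ∀ n → n < p ^ n
n<p^n 2≤p zero    = s≤s z≤n
n<p^n {p} 2≤p (suc n) = begin
  2 + n          ≤⟨ s≤s (n<p^n 2≤p n) ⟩
  1 + p ^ n      ≤⟨ +-monoˡ-≤ (p ^ n) (m^n>0 p {{>-nonZero (<⇒≤ 2≤p)}} n) ⟩
  p ^ n + p ^ n  ≡⟨ cong (λ x → p ^ n + x) (+-identityʳ (p ^ n)) ⟨
  2 * p ^ n      ≤⟨ *-monoˡ-≤ (p ^ n) 2≤p ⟩
  p * p ^ n      ∎
  where open ≤-Reasoning

-- Occurrence of every digit for large n

module _ (m-1 : ℕ) (2≤m-1 : 2 ≤ m-1) {p : ℕ} (pp : Prime p) (p∣m-1 : p ∣ m-1) where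

  private
    m = suc m-1
    -- Large enough that `p ^ g` exceeds 2 * m, by `n<p^n`.
    g = 2 * m
    instance
      p≢0 : NonZero p
      p≢0 = prime⇒nonZero pp
      m-1≢0 : NonZero m-1
      m-1≢0 = >-nonZero (<⇒≤ 2≤m-1)

  p⊥m : Coprime p m
  p⊥m = coprime-1+ p∣m-1

  -- As p divides m - 1, the p-th power gains at least one more factor p. This supplies the exponent
  -- 2 from which lifting the exponent starts.
  m^p≡1+p²⁺ᶠc : ∃₂ λ f c → m ^ p ≡ 1 + p ^ (2 + f) * c × Coprime p c
  m^p≡1+p²⁺ᶠc
    with σ , eq ← [1+a]^t m-1 p
    with v , c , a≡ , p⊥c ← valuation pp (m-1 * (p + m-1 * σ))
      {{m*n≢0 m-1 _ {{it}} {{>-nonZero (≤-trans (>-nonZero⁻¹ p) (m≤m+n p _))}}}}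
    with 2≤v ← ^-∣-cancel pp {2} {v} {c} p⊥c
      (subst₂ _∣_ (cong (p *_) (sym (*-identityʳ p))) a≡
        (*-pres-∣ p∣m-1 (∣m∣n⇒∣m+n ∣-refl (∣m⇒∣m*n σ p∣m-1))))
    with f , refl ← m≤n⇒∃[o]m+o≡n 2≤v
    = f , c , trans eq (cong suc a≡) , p⊥c

  -- The prime p divides the superfactorial but no power of m. Hence the reciprocal has no
  -- terminating expansion, which makes its digits unique.
  superfactorial∤m^k : ∀ {n} → suc p ≤ n → ∀ k → superfactorial n ∤ m ^ k
  superfactorial∤m^k p<n k a∣m^k = contradiction (subst Prime p≡1 pp) ¬prime[1]
    where
    p≡1 : p ≡ 1
    p≡1 = coprime-^ k p⊥m
      (∣-refl , ∣-trans (m∣m*n 1) (∣-trans (p^l∣superfactorial p 1 p<n) a∣m^k))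

  -- The exponent 2 + (v + f) is that of p in (m ^ p) ^ n ∸ 1, one g makes room
  -- for P = p ^ g, and the other g gives P ∣ z.
  split-digit-occurs : ∀ {A n f v c} → .{{NonZero A}} → Split m p (m ^ n) A →
    (m ^ p) ^ n ≡ 1 + p ^ (2 + (v + f)) * c → Coprime p c → p ^ (2 + f + g + g + v) ∣ A →
    ∀ d → DigitOccurs m A d
  split-digit-occurs {A} {n} {f} {v} {c} σ m^pn≡ p⊥c p^∣A d
    with c₁ , eq₁ , p⊥c₁ ← valuation-^-coprime {p} {1 + (v + f)} (Split.t σ) p⊥c (Split.p⊥t σ)
    with c₂ , eq₂ , p⊥c₂ ← valuation-^-^ {p} {v + f} (Split.e σ ∸ (2 + f + g + v)) p⊥c₁ =
    subst (λ A → DigitOccurs m A d) (sym A≡wzP)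
      (digit-occurs {w = w} {h} {κ} {T} {z} {c₃} {{it}} {{m*n≢0⇒m≢0 (w * z) {{subst NonZero A≡wzP it}}}}
        m^κ≡wh m^T≡1+zc₃ P∣z hc₃⊥P (<⇒≤ (n<p^n (nonTrivial⇒n>1 p {{prime⇒nonTrivial pp}}) g)) d)
    where
    open Split σ
    open ≡-Reasoning

    -- Raising to `p ^ i` lifts the exponent of p from `2 + (v + f)` to E, and E + g = e makes A
    -- equal to w * z * P. By `g+[]≤e` nothing is truncated, and i is at least g.
    i = e ∸ (2 + f + g + v)
    E = 2 + (i + (v + f))
    T = p * n * t * p ^ i
    z = s * p ^ E
    P = p ^ g

    p⊥w : Coprime p w
    p⊥w = coprime-∣ʳ w∣m^κ (coprime-^ κ p⊥m)

    exponent≤e : 2 + f + g + g + v ≤ e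
    exponent≤e = ^-∣-cancel pp (coprime-* p⊥w p⊥s)
      (subst (_ ∣_) (trans factored (*-comm (w * s) (p ^ e))) p^∣A)

    g+[]≤e : g + (2 + f + g + v) ≤ e
    g+[]≤e = subst (_≤ e) (lemma f g v) exponent≤e
      where
      lemma : ∀ f g v → 2 + f + g + g + v ≡ g + (2 + f + g + v)
      lemma = solve-∀

    E+g≡e : E + g ≡ e
    E+g≡e = trans (lemma i v f g) (m∸n+n≡m (m+n≤o⇒n≤o g g+[]≤e))
      where
      lemma : ∀ i v f g → 2 + (i + (v + f)) + g ≡ i + (2 + f + g + v)
      lemma = solve-∀

    P∣z : P ∣ z
    P∣z = ∣n⇒∣m*n s (^-monoʳ-∣ p (≤-trans (m+n≤o⇒m≤o∸n g g+[]≤e)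
      (≤-trans (m≤m+n i (v + f)) (m≤n+m _ 2))))

    A≡wzP : A ≡ w * z * P
    A≡wzP = begin
      A                        ≡⟨ factored ⟩
      w * s * p ^ e            ≡⟨ cong (λ k → w * s * p ^ k) E+g≡e ⟨
      w * s * p ^ (E + g)      ≡⟨ cong (w * s *_) (^-distribˡ-+-* p E g) ⟩
      w * s * (p ^ E * p ^ g)  ≡⟨ *-assoc (w * s) (p ^ E) (p ^ g) ⟨
      w * s * p ^ E * p ^ g    ≡⟨ cong (_* p ^ g) (*-assoc w s (p ^ E)) ⟩
      w * z * P                ∎

    h = quotient w∣m^κ
    m^κ≡wh : m ^ κ ≡ w * h
    m^κ≡wh = m∣n⇒n≡m*quotient w∣m^κ

    m^T≡ : m ^ T ≡ 1 + p ^ E * c₂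
    m^T≡ = begin
      m ^ (p * n * t * p ^ i)            ≡⟨ ^-*-assoc m (p * n * t) (p ^ i) ⟨
      (m ^ (p * n * t)) ^ (p ^ i)        ≡⟨ cong (_^ (p ^ i)) (^-*-assoc m (p * n) t) ⟨
      ((m ^ (p * n)) ^ t) ^ (p ^ i)      ≡⟨ cong (λ u → (u ^ t) ^ (p ^ i)) (^-*-assoc m p n) ⟨
      (((m ^ p) ^ n) ^ t) ^ (p ^ i)      ≡⟨ cong (λ u → (u ^ t) ^ (p ^ i)) m^pn≡ ⟩
      ((1 + p ^ (2 + (v + f)) * c) ^ t) ^ (p ^ i) ≡⟨ cong (_^ (p ^ i)) eq₁ ⟩
      (1 + p ^ (2 + (v + f)) * c₁) ^ (p ^ i)      ≡⟨ eq₂ ⟩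
      1 + p ^ E * c₂                     ∎

    -- T is a multiple of n * t, so s divides `m ^ T ∸ 1`, that is `p ^ E * c₂`, and s is prime to
    -- p.
    s∣c₂ : s ∣ c₂
    s∣c₂ with a , m^≡1+a , s∣a ← ≡1-^ {(m ^ n) ^ t} (p * p ^ i) u^t≡1 =
      coprime-divisor (coprime-^ E (coprime-sym p⊥s)) (subst (s ∣_) a≡ s∣a)
      where
      lemma : ∀ n t p q → n * t * (p * q) ≡ p * n * t * q
      lemma = solve-∀
      a≡ : a ≡ p ^ E * c₂
      a≡ = suc-injective (begin
        1 + a                          ≡⟨ m^≡1+a ⟨
        ((m ^ n) ^ t) ^ (p * p ^ i)    ≡⟨ cong (_^ (p * p ^ i)) (^-*-assoc m n t) ⟩
        (m ^ (n * t)) ^ (p * p ^ i)    ≡⟨ ^-*-assoc m (n * t) (p * p ^ i) ⟩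
        m ^ (n * t * (p * p ^ i))      ≡⟨ cong (m ^_) (lemma n t p (p ^ i)) ⟩
        m ^ T                          ≡⟨ m^T≡ ⟩
        1 + p ^ E * c₂                 ∎)

    c₃ = quotient s∣c₂

    m^T≡1+zc₃ : m ^ T ≡ 1 + z * c₃
    m^T≡1+zc₃ = trans m^T≡ (cong suc (begin
      p ^ E * c₂          ≡⟨ cong (p ^ E *_) (m∣n⇒n≡m*quotient s∣c₂) ⟩
      p ^ E * (s * c₃)    ≡⟨ *-assoc (p ^ E) s c₃ ⟨
      p ^ E * s * c₃      ≡⟨ cong (_* c₃) (*-comm (p ^ E) s) ⟩
      s * p ^ E * c₃      ∎))

    hc₃⊥P : Coprime (h * c₃) P
    hc₃⊥P = coprime-^ g (coprime-sym (coprime-*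
      (coprime-∣ʳ (quotient-∣ w∣m^κ) (coprime-^ κ p⊥m)) (coprime-∣ʳ (quotient-∣ s∣c₂) p⊥c₂)))

  -- The factor suc n ! of superfactorial (suc n) contributes p ^ v, and the
  -- remaining superfactorial n contributes p ^ (2 + f + g + g).
  digits-occur : ∃ λ N → ∀ n → N ≤ n → (∀ k → superfactorial n ∤ m ^ k) ×
    (∀ d → DigitOccurs m (superfactorial n) d)
  digits-occur with f , c , m^p≡ , p⊥c ← m^p≡1+p²⁺ᶠc = suc (2 + f + g + g + p) , occur
    where
    occur : ∀ n → suc (2 + f + g + g + p) ≤ n → (∀ k → superfactorial n ∤ m ^ k) ×
      (∀ d → DigitOccurs m (superfactorial n) d)
    occur (suc n) (s≤s N≤n)
      with v , r , n!≡ , p⊥r , c₁ , eq₁ , p⊥c₁ ← valuation-^ {p} {f} pp p⊥c (suc n !) {{suc n !≢0}} =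
      superfactorial∤m^k (s≤s (m+n≤o⇒n≤o (2 + f + g + g) N≤n)) ,
      split-digit-occurs {n = suc n !} {f} {v} {{superfactorial≢0 (suc n)}}
        (split-superfactorial pp (suc n) ≤-refl)
        (trans (cong (_^ (suc n !)) m^p≡) eq₁) p⊥c₁
        (subst (_∣ superfactorial (suc n)) (sym (^-distribˡ-+-* p (2 + f + g + g) v))
          (*-pres-∣ (p^l∣superfactorial p (2 + f + g + g) N≤n) (subst (p ^ v ∣_) (sym n!≡) (m∣m*n r))))

-- Infinite paths in finite graphs

module _ {n ℓ} {R : Rel (Fin n) ℓ} (R? : Decidable R) where

  InfinitePath : Fin n → Set ℓ
  InfinitePath x = ∃ λ (s : ℕ → Fin n) → s 0 ≡ x × (∀ k → R (s k) (s (suc k)))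

  private
    -- A total sequence with only its first l steps constrained, so an infinite path serves as a
    -- finite one of any length.
    FinitePath : ℕ → Fin n → Set ℓ
    FinitePath l x = ∃ λ (s : ℕ → Fin n) → s 0 ≡ x × (∀ k → k < l → R (s k) (s (suc k)))

    finitePath? : ∀ l x → Dec (FinitePath l x)
    finitePath? zero    x = yes ((λ _ → x) , refl , λ _ ())
    finitePath? (suc l) x = map′ cons uncons (any? λ y → R? x y ×-dec finitePath? l y)
      where
      cons : (∃ λ y → R x y × FinitePath l y) → FinitePath (suc l) x
      cons (y , xRy , s , refl , sR) = (λ { zero → x ; (suc k) → s k }) , refl ,
        λ { zero _ → xRy ; (suc k) (s≤s k<l) → sR k k<l }
      uncons : FinitePath (suc l) x → ∃ λ y → R x y × FinitePath l y
      uncons (s , refl , sR) = s 1 , sR 0 (s≤s z≤n) , s ∘ suc , refl , λ k k<l → sR (suc k) (s≤s k<l)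

    -- A path of n steps visits some vertex twice; going around that cycle
    -- forever gives an infinite path.
    lasso : ∀ {x} → FinitePath n x → InfinitePath x
    lasso (s , refl , sR) with i , j , i<j , si≡sj ← pigeonhole (n<1+n n) (s ∘ toℕ) =
      s ∘ proj₁ ∘ index , refl , step
      where
      -- Positions run up to j - 1 and then jump back to i. The bound by j keeps every step among
      -- the n steps that `sR` covers.
      index : ℕ → ∃ (_< toℕ j)
      index zero    = 0 , ≤-<-trans z≤n i<j
      index (suc k) with k′ , k′<j ← index k with suc k′ ≟ toℕ j
      ... | yes _    = toℕ i , i<j
      ... | no k′+1≢j = suc k′ , ≤∧≢⇒< k′<j k′+1≢j
      step : ∀ k → R (s (proj₁ (index k))) (s (proj₁ (index (suc k))))
      step k with k′ , k′<j ← index k with suc k′ ≟ toℕ j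
      ... | yes k′+1≡j = subst (R (s k′)) (trans (cong s k′+1≡j) (sym si≡sj))
        (sR k′ (<-≤-trans k′<j (s≤s⁻¹ (toℕ<n j))))
      ... | no _ = sR k′ (<-≤-trans k′<j (s≤s⁻¹ (toℕ<n j)))

  infinitePath? : ∀ x → Dec (InfinitePath x)
  infinitePath? x = map′ lasso (λ { (s , s0 , sR) → s , s0 , λ k _ → sR k }) (finitePath? n x)

-- Rational points of K

∣+m-+n∣≡∣m-n∣ : ∀ m n → ℤ.∣ + m ℤ.- + n ∣ ≡ ∣ m - n ∣
∣+m-+n∣≡∣m-n∣ m n with ≤-total m n
... | inj₁ m≤n = trans (cong ℤ.∣_∣ (ℤ.m-n≡m⊖n m n)) (trans (ℤ.∣⊖∣-≤ m≤n) (sym (m≤n⇒∣m-n∣≡n∸m m≤n)))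
... | inj₂ n≤m = trans (cong ℤ.∣_∣ (ℤ.m-n≡m⊖n m n)) (trans (ℤ.∣m⊖n∣≡∣n⊖m∣ m n) (trans (ℤ.∣⊖∣-≤ n≤m)
  (sym (trans (∣-∣-comm m n) (m≤n⇒∣m-n∣≡n∸m n≤m)))))

toℚᵘ-/ : ∀ i n .{{_ : NonZero n}} → toℚᵘ (i ℚ./ n) ℚᵘ.≃ i ℚᵘ./ n
toℚᵘ-/ i (suc n-1) = ℚ.toℚᵘ-fromℚᵘ (mkℚᵘ i n-1)

-- Cross multiplication, done in unnormalised rationals where no common factor is cancelled. It
-- reduces convergence to inequalities between naturals.
∣p-q∣<r⇔ : ∀ a b c k l n .{{_ : NonZero k}} .{{_ : NonZero l}} .{{_ : NonZero n}} →
  ℚ.∣ (+ a ℚ./ k) ℚ.- (+ b ℚ./ l) ∣ ℚ.< (+ c ℚ./ n) ⇔ ∣ a * l - b * k ∣ * n < c * (k * l)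
∣p-q∣<r⇔ a b c k@(suc k-1) l@(suc l-1) n@(suc n-1) = mk⇔ to from
  where
  distᵘ = ℚᵘ.∣ mkℚᵘ (+ a) k-1 ℚᵘ.- mkℚᵘ (+ b) l-1 ∣

  dist≃ : toℚᵘ ℚ.∣ (+ a ℚ./ k) ℚ.- (+ b ℚ./ l) ∣ ℚᵘ.≃ distᵘ
  dist≃ = ℚᵘ.≃-trans (ℚ.toℚᵘ-homo-∣-∣ ((+ a ℚ./ k) ℚ.- (+ b ℚ./ l))) (ℚᵘ.∣-∣-cong
    (ℚᵘ.≃-trans (ℚ.toℚᵘ-homo-+ (+ a ℚ./ k) (ℚ.- (+ b ℚ./ l))) (ℚᵘ.+-cong (toℚᵘ-/ (+ a) k)
      (ℚᵘ.≃-trans (ℚ.toℚᵘ-homo‿- (+ b ℚ./ l)) (ℚᵘ.-‿cong (toℚᵘ-/ (+ b) l))))))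

  num≡ : ℤ.∣ + a ℤ.* + l ℤ.+ ℤ.- (+ b) ℤ.* + k ∣ ≡ ∣ a * l - b * k ∣
  num≡ = trans (cong₂ (λ x y → ℤ.∣ x ℤ.+ y ∣) (sym (ℤ.pos-* a l))
      (trans (sym (ℤ.neg-distribˡ-* (+ b) (+ k))) (cong ℤ.-_ (sym (ℤ.pos-* b k)))))
    (∣+m-+n∣≡∣m-n∣ (a * l) (b * k))

  cross≡ : + ℤ.∣ + a ℤ.* + l ℤ.+ ℤ.- (+ b) ℤ.* + k ∣ ℤ.* + n ≡ + (∣ a * l - b * k ∣ * n)
  cross≡ = trans (cong (λ x → + x ℤ.* + n) num≡) (sym (ℤ.pos-* ∣ a * l - b * k ∣ n))

  to : ℚ.∣ (+ a ℚ./ k) ℚ.- (+ b ℚ./ l) ∣ ℚ.< (+ c ℚ./ n) → ∣ a * l - b * k ∣ * n < c * (k * l)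
  to lt with ℚᵘ.<-respˡ-≃ dist≃ (ℚᵘ.<-respʳ-≃ (toℚᵘ-/ (+ c) n) (ℚ.toℚᵘ-mono-< lt))
  ... | *<* lt′ = ℤ.drop‿+<+ (subst₂ ℤ._<_ cross≡ (sym (ℤ.pos-* c (k * l))) lt′)

  from : ∣ a * l - b * k ∣ * n < c * (k * l) → ℚ.∣ (+ a ℚ./ k) ℚ.- (+ b ℚ./ l) ∣ ℚ.< (+ c ℚ./ n)
  from lt = ℚ.toℚᵘ-cancel-< (ℚᵘ.<-respˡ-≃ (ℚᵘ.≃-sym dist≃) (ℚᵘ.<-respʳ-≃ (ℚᵘ.≃-sym (toℚᵘ-/ (+ c) n))
    (*<* (subst₂ ℤ._<_ (sym cross≡) (ℤ.pos-* c (k * l)) (ℤ.+<+ lt)))))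

+-/ : ∀ a d m q .{{_ : NonZero q}} .{{_ : NonZero (m * q)}} →
  (+ a ℚᵘ./ q) ℚᵘ.+ (+ d ℚᵘ./ (m * q)) ℚᵘ.≃ + (a * m + d) ℚᵘ./ (m * q)
+-/ a d m@(suc _) q@(suc _) = *≡* (begin
  (+ a ℤ.* + (m * q) ℤ.+ + d ℤ.* + q) ℤ.* + (m * q)
    ≡⟨ cong (ℤ._* + (m * q)) (cong₂ ℤ._+_ (sym (ℤ.pos-* a (m * q))) (sym (ℤ.pos-* d q))) ⟩
  + (a * (m * q) + d * q) ℤ.* + (m * q)              ≡⟨ ℤ.pos-* (a * (m * q) + d * q) (m * q) ⟨
  + ((a * (m * q) + d * q) * (m * q))                ≡⟨ cong +_ (lemma a d m q) ⟩
  + ((a * m + d) * (q * (m * q)))                    ≡⟨ ℤ.pos-* (a * m + d) (q * (m * q)) ⟩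
  + (a * m + d) ℤ.* + (q * (m * q))                  ∎)
  where
  open ≡-Reasoning
  lemma : ∀ a d m q → (a * (m * q) + d * q) * (m * q) ≡ (a * m + d) * (q * (m * q))
  lemma = solve-∀

0<1/n : ∀ n .{{_ : NonZero n}} → 0ℚ ℚ.< + 1 ℚ./ n
0<1/n n = ℚ.positive⁻¹ (+ 1 ℚ./ n) {{ℚ.normalize-pos 1 n}}

-- Digit expansions and convergence

module _ {m : ℕ} .{{_ : NonZero m}} where

  digits : (ℕ → Fin m) → ℕ → ℕ
  digits b zero    = 0
  digits b (suc n) = digits b n * m + toℕ (b n)

  partialSum≡ : ∀ b n → partialSum b n ≡ (+ digits b n ℚ./ m ^ n) {{m^n≢0 m n}}
  partialSum≡ b zero    = refl
  partialSum≡ b (suc n) =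
    trans (cong (ℚ._+ digitTerm (b n) (suc n)) (partialSum≡ b n)) (ℚ.toℚᵘ-injective (begin
      toℚᵘ ((+ x ℚ./ m ^ n) ℚ.+ (+ d ℚ./ m ^ suc n))
        ≈⟨ ℚ.toℚᵘ-homo-+ (+ x ℚ./ m ^ n) (+ d ℚ./ m ^ suc n) ⟩
      toℚᵘ (+ x ℚ./ m ^ n) ℚᵘ.+ toℚᵘ (+ d ℚ./ m ^ suc n)
        ≈⟨ ℚᵘ.+-cong (toℚᵘ-/ (+ x) (m ^ n)) (toℚᵘ-/ (+ d) (m ^ suc n)) ⟩
      (+ x ℚᵘ./ m ^ n) ℚᵘ.+ (+ d ℚᵘ./ m ^ suc n)                ≈⟨ +-/ x d m (m ^ n) ⟩
      + (x * m + d) ℚᵘ./ m ^ suc n                              ≈⟨ toℚᵘ-/ (+ (x * m + d)) (m ^ suc n) ⟨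
      toℚᵘ (+ (x * m + d) ℚ./ m ^ suc n)                        ∎))
    where
    open ℚᵘ.≃-Reasoning
    x = digits b n
    d = toℕ (b n)
    instance
      m^n≢0′ : NonZero (m ^ n)
      m^n≢0′ = m^n≢0 m n
      m^1+n≢0 : NonZero (m ^ suc n)
      m^1+n≢0 = m^n≢0 m (suc n)

  digits-lower : ∀ b l k → digits b k * m ^ l ≤ digits b (l + k)
  digits-lower b zero    k = ≤-reflexive (*-identityʳ (digits b k))
  digits-lower b (suc l) k = begin
    digits b k * (m * m ^ l)  ≡⟨ lemma (digits b k) m (m ^ l) ⟩
    digits b k * m ^ l * m    ≤⟨ *-monoˡ-≤ m (digits-lower b l k) ⟩
    digits b (l + k) * m      ≤⟨ m≤m+n _ _ ⟩
    digits b (suc l + k)      ∎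
    where
    open ≤-Reasoning
    lemma : ∀ x m q → x * (m * q) ≡ x * q * m
    lemma = solve-∀

  digits-upper : ∀ b l k → digits b (l + k) < suc (digits b k) * m ^ l
  digits-upper b zero    k = ≤-reflexive (sym (*-identityʳ (suc (digits b k))))
  digits-upper b (suc l) k = begin-strict
    digits b (l + k) * m + toℕ (b (l + k))  <⟨ +-monoʳ-< _ (toℕ<n (b (l + k))) ⟩
    digits b (l + k) * m + m                ≡⟨ +-comm _ m ⟩
    suc (digits b (l + k)) * m              ≤⟨ *-monoˡ-≤ m (digits-upper b l k) ⟩
    suc (digits b k) * m ^ l * m            ≡⟨ lemma (suc (digits b k)) m (m ^ l) ⟩
    suc (digits b k) * (m * m ^ l)          ∎
    where
    open ≤-Reasoning
    lemma : ∀ x m q → x * q * m ≡ x * (m * q)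
    lemma = solve-∀

  -- Places a / N in the closed interval from `digits b k` to `digits b k + 1`, both over `m ^ k`,
  -- for every k. The upper end is included because digits that are eventually all m - 1 attain it.
  Expansion : ℕ → ℕ → (ℕ → Fin m) → Set
  Expansion a N b = ∀ k → N * digits b k ≤ m ^ k * a × m ^ k * a ≤ N * digits b k + N

  module _ {a N : ℕ} .{{_ : NonZero N}} {b : ℕ → Fin m} where

    -- The k-th partial sum has error at most 1 / m ^ k. For ε = (1 + p) / (1 + q) every k > q
    -- suffices, since k < m ^ k.
    expansion⇒⟶ : 2 ≤ m → Expansion a N b → partialSum b ⟶ (+ a ℚ./ N)
    expansion⇒⟶ 2≤m ex (mkℚ +0 q _) (ℚ.*<* (ℤ.+<+ ()))
    expansion⇒⟶ 2≤m ex ε@(mkℚ +[1+ p ] q _) _ = suc q , λ k q<k →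
      subst₂ (λ x y → ℚ.∣ x ℚ.- (+ a ℚ./ N) ∣ ℚ.< y) (sym (partialSum≡ b k)) (ℚ.↥p/↧p≡p ε)
        (Equivalence.from (∣p-q∣<r⇔ (digits b k) a (suc p) (m ^ k) N (suc q) {{m^n≢0 m k}}) (bound k q<k))
      where
      bound : ∀ k → q < k → ∣ digits b k * N - a * m ^ k ∣ * suc q < suc p * (m ^ k * N)
      bound k q<k = begin-strict
        ∣ digits b k * N - a * m ^ k ∣ * suc q  ≤⟨ *-monoˡ-≤ (suc q) dist≤N ⟩
        N * suc q                               ≤⟨ *-monoʳ-≤ N q<k ⟩
        N * k                                   <⟨ *-monoʳ-< N (n<p^n 2≤m k) ⟩
        N * m ^ k                               ≡⟨ *-comm N (m ^ k) ⟩
        m ^ k * N                               ≤⟨ m≤m+n _ _ ⟩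
        suc p * (m ^ k * N)                     ∎
        where
        open ≤-Reasoning
        lower = subst₂ _≤_ (*-comm N (digits b k)) (*-comm (m ^ k) a) (proj₁ (ex k))
        upper = subst₂ _≤_ (*-comm (m ^ k) a) (cong (_+ N) (*-comm N (digits b k))) (proj₂ (ex k))
        dist≤N : ∣ digits b k * N - a * m ^ k ∣ ≤ N
        dist≤N = subst (_≤ N) (sym (m≤n⇒∣m-n∣≡n∸m lower)) (m≤n+o⇒m∸n≤o _ (digits b k * N) upper)

    -- The tolerance is chosen so that clearing denominators cancels `N * m ^ k` and leaves an error
    -- below `m ^ l`, the scale of one unit at position k.
    ⟶⇒close : partialSum b ⟶ (+ a ℚ./ N) → ∀ k →
      ∃ λ l → ∣ digits b (l + k) * N - a * m ^ (l + k) ∣ < m ^ l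
    ⟶⇒close lim k = map₂ close (lim (+ 1 ℚ./ (N * m ^ k)) (0<1/n (N * m ^ k)))
      where
      instance
        Nm^k≢0 : NonZero (N * m ^ k)
        Nm^k≢0 = m*n≢0 N (m ^ k) {{it}} {{m^n≢0 m k}}
      lemma : ∀ p q N → 1 * (p * q * N) ≡ p * (N * q)
      lemma = solve-∀
      close : ∀ {l} → (∀ n → l ≤ n → ℚ.∣ partialSum b n ℚ.- (+ a ℚ./ N) ∣ ℚ.< + 1 ℚ./ (N * m ^ k)) →
        ∣ digits b (l + k) * N - a * m ^ (l + k) ∣ < m ^ l
      close {l} <ε = *-cancelʳ-< (N * m ^ k) dist (m ^ l) (subst (dist * (N * m ^ k) <_)
        (trans (cong (λ q → 1 * (q * N)) (^-distribˡ-+-* m l k)) (lemma (m ^ l) (m ^ k) N))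
        (Equivalence.to (∣p-q∣<r⇔ (digits b (l + k)) a 1 (m ^ (l + k)) N (N * m ^ k) {{m^n≢0 m (l + k)}})
          (subst (λ x → ℚ.∣ x ℚ.- (+ a ℚ./ N) ∣ ℚ.< + 1 ℚ./ (N * m ^ k)) (partialSum≡ b (l + k))
            (<ε (l + k) (m≤m+n l k)))))
        where
        dist = ∣ digits b (l + k) * N - a * m ^ (l + k) ∣

    -- An integer inequality that fails at k fails by at least 1, hence by at least `m ^ l` after
    -- scaling to l + k. `digits-lower` and `digits-upper` keep the later digits from making up for
    -- this.
    close⇒bounds : ∀ k l → ∣ digits b (l + k) * N - a * m ^ (l + k) ∣ < m ^ l →
      N * digits b k ≤ m ^ k * a × m ^ k * a ≤ N * digits b k + N
    close⇒bounds k l close = ≮⇒≥ ¬below , ≮⇒≥ ¬above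
      where
      X = digits b (l + k) * N
      Y = a * m ^ (l + k)

      m^l[m^ka]≡Y : m ^ l * (m ^ k * a) ≡ Y
      m^l[m^ka]≡Y = trans (lemma (m ^ l) (m ^ k) a) (cong (a *_) (sym (^-distribˡ-+-* m l k)))
        where
        lemma : ∀ p q a → p * (q * a) ≡ a * (p * q)
        lemma = solve-∀

      ¬below : m ^ k * a ≮ N * digits b k
      ¬below lt = <-irrefl refl (begin-strict
        Y + m ^ l                       ≡⟨ +-comm Y (m ^ l) ⟩
        m ^ l + Y                       ≡⟨ cong (λ x → m ^ l + x) m^l[m^ka]≡Y ⟨
        m ^ l + m ^ l * (m ^ k * a)     ≡⟨ *-suc (m ^ l) (m ^ k * a) ⟨
        m ^ l * suc (m ^ k * a)         ≤⟨ *-monoʳ-≤ (m ^ l) lt ⟩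
        m ^ l * (N * digits b k)        ≡⟨ lemma (m ^ l) N (digits b k) ⟩
        digits b k * m ^ l * N          ≤⟨ *-monoˡ-≤ N (digits-lower b l k) ⟩
        X                               ≤⟨ m≤n+∣m-n∣ X Y ⟩
        Y + ∣ X - Y ∣                   <⟨ +-monoʳ-< Y close ⟩
        Y + m ^ l                       ∎)
        where
        open ≤-Reasoning
        lemma : ∀ p N x → p * (N * x) ≡ x * p * N
        lemma = solve-∀

      ¬above : N * digits b k + N ≮ m ^ k * a
      ¬above lt = <-irrefl refl (begin-strict
        X + m ^ l
          ≤⟨ +-monoˡ-≤ (m ^ l) (*-monoˡ-≤ N (<⇒≤ (digits-upper b l k))) ⟩
        suc (digits b k) * m ^ l * N + m ^ l     ≡⟨ lemma (digits b k) (m ^ l) N ⟩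
        m ^ l * suc (N * digits b k + N)         ≤⟨ *-monoʳ-≤ (m ^ l) lt ⟩
        m ^ l * (m ^ k * a)                      ≡⟨ m^l[m^ka]≡Y ⟩
        Y                                        ≤⟨ m≤n+∣n-m∣ Y X ⟩
        X + ∣ X - Y ∣                            <⟨ +-monoʳ-< X close ⟩
        X + m ^ l                                ∎)
        where
        open ≤-Reasoning
        lemma : ∀ x p N → (1 + x) * p * N + p ≡ p * (1 + (N * x + N))
        lemma = solve-∀

    ⟶⇒expansion : partialSum b ⟶ (+ a ℚ./ N) → Expansion a N b
    ⟶⇒expansion lim k = close⇒bounds k (proj₁ (⟶⇒close lim k)) (proj₂ (⟶⇒close lim k))

  -- Long division and decidability of membership

  module _ (2≤m : 2 ≤ m) (D : Subset m) {a N : ℕ} .{{_ : NonZero N}} (a≤N : a ≤ N) where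

    private
      -- The state y stands for the remainder y / N, which satisfies
      -- y / N = d / m + (y′ / N) / m when the next digit is d.
      Step : Rel (Fin (suc N)) 0ℓ
      Step y y′ = ∃ λ d → d ∈ D × m * toℕ y ≡ toℕ d * N + toℕ y′

      step? : Decidable Step
      step? y y′ = any? λ d → (d ∈? D) ×-dec (m * toℕ y ≟ toℕ d * N + toℕ y′)

      y₀ : Fin (suc N)
      y₀ = fromℕ< (s≤s a≤N)

      path⇒K : InfinitePath step? y₀ → K m D (+ a ℚ./ N)
      path⇒K (y , y0≡ , yR) = b , proj₁ ∘ proj₂ ∘ yR , expansion⇒⟶ {a} {N} 2≤m ex
        where
        b = proj₁ ∘ yR
        remainder : ∀ k → N * digits b k + toℕ (y k) ≡ m ^ k * a
        remainder zero = trans (cong₂ _+_ (*-zeroʳ N) (trans (cong toℕ y0≡) (toℕ-fromℕ< _)))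
          (sym (+-identityʳ a))
        remainder (suc k) = begin
          N * (digits b k * m + toℕ (b k)) + toℕ (y (suc k))
            ≡⟨ lemma₁ N (digits b k) m (toℕ (b k)) (toℕ (y (suc k))) ⟩
          m * (N * digits b k) + (toℕ (b k) * N + toℕ (y (suc k)))
            ≡⟨ cong (λ x → m * (N * digits b k) + x) (proj₂ (proj₂ (yR k))) ⟨
          m * (N * digits b k) + m * toℕ (y k)                  ≡⟨ *-distribˡ-+ m _ _ ⟨
          m * (N * digits b k + toℕ (y k))                      ≡⟨ cong (m *_) (remainder k) ⟩
          m * (m ^ k * a)                                       ≡⟨ *-assoc m (m ^ k) a ⟨
          m ^ suc k * a                                         ∎
          where
          open ≡-Reasoning
          lemma₁ : ∀ N x m d y → N * (x * m + d) + y ≡ m * (N * x) + (d * N + y)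
          lemma₁ = solve-∀
        ex : Expansion a N b
        ex k = subst (N * digits b k ≤_) (remainder k) (m≤m+n _ _) ,
          subst (_≤ N * digits b k + N) (remainder k) (+-monoʳ-≤ _ (s≤s⁻¹ (toℕ<n (y k))))

      K⇒path : K m D (+ a ℚ./ N) → InfinitePath step? y₀
      K⇒path (b , b∈D , lim) = y , toℕ-injective y0≡ , λ k → b k , b∈D k , step k
        where
        ex : Expansion a N b
        ex = ⟶⇒expansion {a} {N} lim
        y : ℕ → Fin (suc N)
        -- The remainder may be N itself, when all later digits are m - 1; hence `suc N` states.
        y k = fromℕ< (s≤s (m≤n+o⇒m∸n≤o (m ^ k * a) (N * digits b k) (proj₂ (ex k))))
        toℕ-y : ∀ k → toℕ (y k) ≡ m ^ k * a ∸ N * digits b k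
        toℕ-y k = toℕ-fromℕ< _
        remainder : ∀ k → N * digits b k + toℕ (y k) ≡ m ^ k * a
        remainder k = trans (cong (λ x → N * digits b k + x) (toℕ-y k)) (m+[n∸m]≡n (proj₁ (ex k)))
        y0≡ : toℕ (y 0) ≡ toℕ y₀
        y0≡ = trans (toℕ-y 0) (trans (cong₂ _∸_ (+-identityʳ a) (*-zeroʳ N)) (sym (toℕ-fromℕ< _)))
        step : ∀ k → m * toℕ (y k) ≡ toℕ (b k) * N + toℕ (y (suc k))
        step k = +-cancelˡ-≡ (m * (N * digits b k)) _ _ (begin
          m * (N * digits b k) + m * toℕ (y k)                  ≡⟨ *-distribˡ-+ m _ _ ⟨
          m * (N * digits b k + toℕ (y k))                      ≡⟨ cong (m *_) (remainder k) ⟩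
          m * (m ^ k * a)                                       ≡⟨ *-assoc m (m ^ k) a ⟨
          m ^ suc k * a                                         ≡⟨ remainder (suc k) ⟨
          N * (digits b k * m + toℕ (b k)) + toℕ (y (suc k))
            ≡⟨ lemma₁ N (digits b k) m (toℕ (b k)) (toℕ (y (suc k))) ⟩
          m * (N * digits b k) + (toℕ (b k) * N + toℕ (y (suc k))) ∎)
          where
          open ≡-Reasoning
          lemma₁ : ∀ N x m d y → N * (x * m + d) + y ≡ m * (N * x) + (d * N + y)
          lemma₁ = solve-∀

    K? : Dec (K m D (+ a ℚ./ N))
    K? = map′ path⇒K K⇒path (infinitePath? step? y₀)

  -- The closed interval agrees with Euclidean division except at its upper end `A * q + A`, which
  -- `A ∤ x` excludes.
  quotient-unique : ∀ {A x q q′ y} → .{{NonZero A}} → A ∤ x → A * q ≤ x → x ≤ A * q + A →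
    x ≡ y + A * q′ → y < A → q ≡ q′
  quotient-unique {A} {x} {q} {q′} {y} A∤x Aq≤x x≤Aq+A x≡ y<A = ≤-antisym
    (s≤s⁻¹ (*-cancelˡ-< A q (suc q′) (begin-strict
      A * q       ≤⟨ Aq≤x ⟩
      x           ≡⟨ x≡ ⟩
      y + A * q′  <⟨ +-monoˡ-< (A * q′) y<A ⟩
      A + A * q′  ≡⟨ *-suc A q′ ⟨
      A * suc q′  ∎)))
    (s≤s⁻¹ (*-cancelˡ-< A q′ (suc q) (begin-strict
      A * q′      ≤⟨ m≤n+m _ y ⟩
      y + A * q′  ≡⟨ x≡ ⟨
      x           <⟨ ≤∧≢⇒< x≤Aq+A (λ x≡Aq+A → A∤x (subst (A ∣_) (sym x≡Aq+A) (∣m∣n⇒∣m+n (m∣m*n q) ∣-refl))) ⟩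
      A * q + A   ≡⟨ +-comm (A * q) A ⟩
      A + A * q   ≡⟨ *-suc A q ⟨
      A * suc q   ∎)))
    where open ≤-Reasoning

  -- Both `digits b k` and `digits b (suc k)` are Euclidean quotients of powers of m by A, and
  -- comparing them leaves the digit d.
  expansion-digit : ∀ {A b} {d : Fin m} → .{{NonZero A}} → (∀ k → A ∤ m ^ k) → Expansion 1 A b →
    DigitOccurs m A (toℕ d) → ∃ λ k → b k ≡ d
  expansion-digit {A} {b} {d} A∤m^k ex (k , q , y , y′ , m^k≡ , my≡ , y′<A) = k ,
    toℕ-injective (+-cancelˡ-≡ (q * m) _ _ (trans (cong (λ x → x * m + toℕ (b k)) (sym digits≡q)) digits≡qm+d))
    where
    quotient≡ : ∀ k {q y} → m ^ k ≡ y + A * q → y < A → digits b k ≡ q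
    quotient≡ k = quotient-unique (A∤m^k k) (subst (A * digits b k ≤_) (*-identityʳ (m ^ k)) (proj₁ (ex k)))
      (subst (_≤ A * digits b k + A) (*-identityʳ (m ^ k)) (proj₂ (ex k)))
    y<A : y < A
    y<A = *-cancelˡ-< m y A (begin-strict
      m * y                ≡⟨ my≡ ⟩
      toℕ d * A + y′       <⟨ +-monoʳ-< (toℕ d * A) y′<A ⟩
      toℕ d * A + A        ≡⟨ +-comm (toℕ d * A) A ⟩
      suc (toℕ d) * A      ≤⟨ *-monoˡ-≤ A (toℕ<n d) ⟩
      m * A                ∎)
      where open ≤-Reasoning
    digits≡q : digits b k ≡ q
    digits≡q = quotient≡ k m^k≡ y<A
    digits≡qm+d : digits b (suc k) ≡ q * m + toℕ d
    digits≡qm+d = quotient≡ (suc k) (begin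
      m * m ^ k                      ≡⟨ cong (m *_) m^k≡ ⟩
      m * (y + A * q)                ≡⟨ *-distribˡ-+ m y (A * q) ⟩
      m * y + m * (A * q)            ≡⟨ cong (_+ m * (A * q)) my≡ ⟩
      toℕ d * A + y′ + m * (A * q)   ≡⟨ lemma (toℕ d) A y′ m q ⟩
      y′ + A * (q * m + toℕ d)       ∎) y′<A
      where
      open ≡-Reasoning
      lemma : ∀ d A y m q → d * A + y + m * (A * q) ≡ y + A * (q * m + d)
      lemma = solve-∀

-- Finiteness of the intersection

∃∉ : ∀ {n} (D : Subset n) → ∣ D ∣ < n → ∃ (_∉ D)
∃∉ {n} D ∣D∣<n with any? (λ d → ¬? (d ∈? D))
... | yes d∉D = d∉D
... | no ¬d∉D = contradiction (subst (_≤ ∣ D ∣) (∣⊤∣≡n n)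
  (p⊆q⇒∣p∣≤∣q∣ {p = ⊤} {D} λ {d} _ → decidable-stable (d ∈? D) λ d∉D → ¬d∉D (d , d∉D))) (<⇒≱ ∣D∣<n)

1/superfactorial∉K : ∀ {m} → 3 ≤ m → (D : Subset m) → ∣ D ∣ < m →
  ∃ λ N → ∀ n → N ≤ n → ¬ K m D (1/superfactorial n)
1/superfactorial∉K {suc m-1} (s≤s 2≤m-1) D ∣D∣<m =
  let p , pp , p∣m-1 = ∃-prime-divisor m-1 2≤m-1
      d , d∉D        = ∃∉ D ∣D∣<m
      N , occur      = digits-occur m-1 2≤m-1 pp p∣m-1
  in N , λ n N≤n (b , b∈D , lim) →
    let instance _ = superfactorial≢0 n
        ∤m^k , occurs = occur n N≤n
        k , bk≡d = expansion-digit {b = b} ∤m^k (⟶⇒expansion {a = 1} {superfactorial n} lim) (occurs (toℕ d))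
    in d∉D (subst (_∈ D) bk≡d (b∈D k))

-- Exact enumeration needs P decided at each n up to the threshold, whence the filter.
-- `applyUpTo suc N` lists 1 to N, so index 0 is left out.
finite-image : ∀ {a ℓ} {A : Set a} (f : ℕ → A) {P : Pred A ℓ} → (∀ n → Dec (P (f n))) → ∀ N →
  (∀ n → N ≤ n → ¬ P (f n)) → Finite ((λ x → ∃ λ n → 1 ≤ n × x ≡ f n) ∩ P)
finite-image f {P} P? N ¬P = map f (filter P? (applyUpTo suc N)) , λ x → mk⇔ to from
  where
  to : ∀ {x} → (∃ λ n → 1 ≤ n × x ≡ f n) × P x → x ∈ˡ map f (filter P? (applyUpTo suc N))
  to ((suc n , s≤s z≤n , refl) , Pfn) = ∈-map⁺ f (∈-filter⁺ P? (∈-applyUpTo⁺ suc n<N) Pfn)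
    where
    n<N : n < N
    n<N = ≰⇒> λ N≤n → ¬P (suc n) (m≤n⇒m≤1+n N≤n) Pfn
  from : ∀ {x} → x ∈ˡ map f (filter P? (applyUpTo suc N)) → (∃ λ n → 1 ≤ n × x ≡ f n) × P x
  from x∈
    with _ , n∈ , refl ← ∈-map⁻ f x∈
    with n∈′ , Pfn ← ∈-filter⁻ P? {xs = applyUpTo suc N} n∈
    with i , i<N , refl ← ∈-applyUpTo⁻ suc n∈′ =
    (suc i , s≤s z≤n , refl) , Pfn

proposition4p5 : (m : ℕ) → 3 ≤ m → (D : Subset m) → 1 < ∣ D ∣ → ∣ D ∣ < m →
    Finite (Reciprocals ∩ K m D)
proposition4p5 m 3≤m D _ ∣D∣<m =
  let N , ∉K = 1/superfactorial∉K 3≤m D ∣D∣<m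
  in finite-image 1/superfactorial 1/superfactorial∈K? N ∉K
  where
  1/superfactorial∈K? : ∀ n → Dec (K m D (1/superfactorial n))
  1/superfactorial∈K? n = K? (<⇒≤ 3≤m) D {1} {superfactorial n} (>-nonZero⁻¹ (superfactorial n))
    where instance
      m≢0 = >-nonZero (<⇒≤ (<⇒≤ 3≤m))
      sf≢0 = superfactorial≢0 n
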